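{- For each $k \ge 0$ let $A_k(z) = \sum_{n \geq 0} \mathcal{B}_{k,n} z^n$ ($z \in \mathbb{C}$) be the univariate ordinary generating function of the $k$-th row of the Binomiacci numbers, and let $G(z,w) = \sum_{k \geq 0} \sum_{n \geq 0} \mathcal{B}_{k,n} z^n w^k$ ($z,w \in \mathbb{C}$) be the corresponding bivariate generating function. Then $$A_k(z) = \begin{cases} \dfrac{1}{1-z-z^2}, & \text{if } k=0,\\[2mm] \dfrac{1}{(1-z)(1-z-z^2)}, & \text{if } k=1,\\[2mm] \dfrac{1}{(1-z)^k(1-z-z^2)} + \displaystyle\sum_{i=0}^{k-2} \frac{\mathcal{F}_i}{(1-z)^{k-1-i}}, & \text{if } k \geq 2, \end{cases}$$ and $$G(z,w) = \frac{1 - z - w + zw - z^2 w^2}{(1-z-z^2)(1-w-w^2)(1-z-w)}.$$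
   Context: $\langle \mathcal{F}_j \rangle_{j\ge 0} = \langle 1,1,2,3,5,8,13,\ldots\rangle$ is the Fibonacci sequence indexed so that $\mathcal{F}_0=\mathcal{F}_1=1$ and $\mathcal{F}_{j+2}=\mathcal{F}_{j+1}+\mathcal{F}_j$. The Binomiacci numbers $\langle \mathcal{B}_{k,n}\rangle_{k,n\ge 0}$ are defined by $\mathcal{B}_{0,n}=\mathcal{F}_n$ for $n\ge 0$, $\mathcal{B}_{k,0}=\mathcal{F}_k$ for $k\ge 0$, and $\mathcal{B}_{k,n}=\mathcal{B}_{k,n-1}+\mathcal{B}_{k-1,n}$ for $k,n\ge 1$. The identities are identities of (formal) power series, i.e. the rational functions are expanded at the origin. -}

module Defs where

open import Algebra.Bundles using (CommutativeRing)
import Algebra.Construct.Pointwise as Pointwise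
import Algebra.Properties.Semiring.Exp
import Algebra.Properties.Semiring.Mult
import Algebra.Properties.Semiring.Sum
open import Data.Fin.Base using (toℕ)
open import Data.Nat.Base as ℕ using (ℕ; zero; suc; _∸_)
open import Data.Product.Base using (_,_)
import Relation.Binary.Reasoning.Setoid

fib : ℕ → ℕ
fib zero          = 1
fib (suc zero)    = 1
fib (suc (suc j)) = fib (suc j) ℕ.+ fib j

binomiacci : ℕ → ℕ → ℕ
binomiacci zero    n       = fib n
binomiacci (suc k) zero    = fib (suc k)
binomiacci (suc k) (suc n) = binomiacci (suc k) n ℕ.+ binomiacci k (suc n)

-- A formal power series over R is its coefficient sequence; two series are
-- equal when all their coefficients are.
module FormalPowerSeries {c ℓ} (R : CommutativeRing c ℓ) where

  open CommutativeRing R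
  open Algebra.Properties.Semiring.Sum semiring
  open Relation.Binary.Reasoning.Setoid setoid

  Series : Set c
  Series = ℕ → Carrier

  const : Carrier → Series
  const a zero    = a
  const a (suc _) = 0#

  var : Series
  var zero          = 0#
  var (suc zero)    = 1#
  var (suc (suc _)) = 0#

  infix  4 _≋_
  infixl 6 _⊕_
  infixl 7 _⊛_

  _≋_ : Series → Series → Set ℓ
  f ≋ g = ∀ n → f n ≈ g n

  _⊕_ : Series → Series → Series
  (f ⊕ g) n = f n + g n

  _⊛_ : Series → Series → Series
  (f ⊛ g) n = ∑[ i ≤ n ] (f (toℕ i) * g (n ∸ toℕ i))

  -- Power series long division: `divide u f g` is the expansion at the origin
  -- of f / g, where u is the inverse of the constant term of g (see
  -- `divide-correct`); the value is meaningless for any other u.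
  divide : Carrier → Series → Series → Series
  divide u f g zero    = u * f 0
  divide u f g (suc n) = divide u (λ m → f (suc m) - (u * f 0) * g (suc m)) g n

  tail : Series → Series
  tail f n = f (suc n)

  ⊛-cong : ∀ {f f′ g g′} → f ≋ f′ → g ≋ g′ → f ⊛ g ≋ f′ ⊛ g′
  ⊛-cong f≋f′ g≋g′ n =
    sum-cong-≋ {suc n} (λ i → *-cong (f≋f′ (toℕ i)) (g≋g′ (n ∸ toℕ i)))

  interchange : ∀ a b x y → (a + b) + (x + y) ≈ (a + x) + (b + y)
  interchange a b x y = begin
    (a + b) + (x + y) ≈⟨ +-assoc a b (x + y) ⟩
    a + (b + (x + y)) ≈⟨ +-congˡ (+-assoc b x y) ⟨
    a + ((b + x) + y) ≈⟨ +-congˡ (+-congʳ (+-comm b x)) ⟩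
    a + ((x + b) + y) ≈⟨ +-congˡ (+-assoc x b y) ⟩
    a + (x + (b + y)) ≈⟨ +-assoc a x (b + y) ⟨
    (a + x) + (b + y) ∎

  ⊛-distribʳ : ∀ h f g → (f ⊕ g) ⊛ h ≋ (f ⊛ h) ⊕ (g ⊛ h)
  ⊛-distribʳ h f g zero = begin
    (f 0 + g 0) * h 0 + 0#                  ≈⟨ +-cong (distribʳ (h 0) (f 0) (g 0)) (sym (+-identityˡ 0#)) ⟩
    (f 0 * h 0 + g 0 * h 0) + (0# + 0#)     ≈⟨ interchange _ _ _ _ ⟩
    (f 0 * h 0 + 0#) + (g 0 * h 0 + 0#)     ∎
  ⊛-distribʳ h f g (suc n) = begin
    (f 0 + g 0) * h (suc n) + ((tail f ⊕ tail g) ⊛ h) n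
      ≈⟨ +-cong (distribʳ _ _ _) (⊛-distribʳ h (tail f) (tail g) n) ⟩
    (f 0 * h (suc n) + g 0 * h (suc n)) + ((tail f ⊛ h) n + (tail g ⊛ h) n)
      ≈⟨ interchange _ _ _ _ ⟩
    (f 0 * h (suc n) + (tail f ⊛ h) n) + (g 0 * h (suc n) + (tail g ⊛ h) n) ∎

  ⊛-scale : ∀ a f g n → ((λ m → a * f m) ⊛ g) n ≈ a * (f ⊛ g) n
  ⊛-scale a f g n = begin
    ∑[ i < suc n ] ((a * f (toℕ i)) * g (n ∸ toℕ i)) ≈⟨ sum-cong-≋ {suc n} (λ i → *-assoc a (f (toℕ i)) (g (n ∸ toℕ i))) ⟩
    ∑[ i < suc n ] (a * (f (toℕ i) * g (n ∸ toℕ i))) ≈⟨ *-distribˡ-sum a (λ i → f (toℕ {suc n} i) * g (n ∸ toℕ i)) ⟨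
    a * (f ⊛ g) n                                    ∎

  ⊛-unfoldʳ : ∀ f g n → (f ⊛ g) (suc n) ≈ (f ⊛ tail g) n + f (suc n) * g 0
  ⊛-unfoldʳ f g zero = begin
    f 0 * g 1 + (f 1 * g 0 + 0#) ≈⟨ +-congˡ (+-comm _ _) ⟩
    f 0 * g 1 + (0# + f 1 * g 0) ≈⟨ +-assoc _ _ _ ⟨
    (f 0 * g 1 + 0#) + f 1 * g 0 ∎
  ⊛-unfoldʳ f g (suc n) = begin
    f 0 * g (suc (suc n)) + (tail f ⊛ g) (suc n)
      ≈⟨ +-congˡ (⊛-unfoldʳ (tail f) g n) ⟩
    f 0 * g (suc (suc n)) + ((tail f ⊛ tail g) n + f (suc (suc n)) * g 0)
      ≈⟨ +-assoc _ _ _ ⟨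
    (f ⊛ tail g) (suc n) + f (suc (suc n)) * g 0 ∎

  ⊛-comm : ∀ f g → f ⊛ g ≋ g ⊛ f
  ⊛-comm f g zero    = +-congʳ (*-comm (f 0) (g 0))
  ⊛-comm f g (suc n) = begin
    f 0 * g (suc n) + (tail f ⊛ g) n ≈⟨ +-cong (*-comm _ _) (⊛-comm (tail f) g n) ⟩
    g (suc n) * f 0 + (g ⊛ tail f) n ≈⟨ +-comm _ _ ⟩
    (g ⊛ tail f) n + g (suc n) * f 0 ≈⟨ ⊛-unfoldʳ g f n ⟨
    (g ⊛ f) (suc n)                  ∎

  ⊛-assoc : ∀ f g h → (f ⊛ g) ⊛ h ≋ f ⊛ (g ⊛ h)
  ⊛-assoc f g h zero = +-congʳ (begin
    (f 0 * g 0 + 0#) * h 0 ≈⟨ *-congʳ (+-identityʳ _) ⟩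
    f 0 * g 0 * h 0        ≈⟨ *-assoc _ _ _ ⟩
    f 0 * (g 0 * h 0)      ≈⟨ *-congˡ (+-identityʳ _) ⟨
    f 0 * (g 0 * h 0 + 0#) ∎)
  ⊛-assoc f g h (suc n) = begin
    (f 0 * g 0 + 0#) * h (suc n) + (((λ m → f 0 * tail g m) ⊕ (tail f ⊛ g)) ⊛ h) n
      ≈⟨ +-cong (trans (*-congʳ (+-identityʳ _)) (*-assoc _ _ _)) (⊛-distribʳ h (λ m → f 0 * tail g m) (tail f ⊛ g) n) ⟩
    f 0 * (g 0 * h (suc n)) + (((λ m → f 0 * tail g m) ⊛ h) n + ((tail f ⊛ g) ⊛ h) n)
      ≈⟨ +-congˡ (+-cong (⊛-scale (f 0) (tail g) h n) (⊛-assoc (tail f) g h n)) ⟩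
    f 0 * (g 0 * h (suc n)) + (f 0 * (tail g ⊛ h) n + (tail f ⊛ (g ⊛ h)) n)
      ≈⟨ +-assoc _ _ _ ⟨
    f 0 * (g 0 * h (suc n)) + f 0 * (tail g ⊛ h) n + (tail f ⊛ (g ⊛ h)) n
      ≈⟨ +-congʳ (distribˡ _ _ _) ⟨
    f 0 * (g ⊛ h) (suc n) + (tail f ⊛ (g ⊛ h)) n ∎

  ⊛-zeroˡ : ∀ f n → ((λ _ → 0#) ⊛ f) n ≈ 0#
  ⊛-zeroˡ f n = trans (sum-cong-≋ {suc n} (λ i → zeroˡ (f (n ∸ toℕ i)))) (sum-replicate-zero (suc n))

  ⊛-identityˡ : ∀ f → const 1# ⊛ f ≋ f
  ⊛-identityˡ f zero    = trans (+-identityʳ _) (*-identityˡ _)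
  ⊛-identityˡ f (suc n) =
    trans (+-cong (*-identityˡ _) (⊛-zeroˡ f n)) (+-identityʳ _)

  powerSeries : CommutativeRing c ℓ
  powerSeries = record
    { Carrier = Series
    ; _≈_ = _≋_
    ; _+_ = _⊕_
    ; _*_ = _⊛_
    ; -_  = λ f n → - f n
    ; 0#  = λ _ → 0#
    ; 1#  = const 1#
    ; isCommutativeRing = record
      { isRing = record
        { +-isAbelianGroup = Pointwise.isAbelianGroup ℕ +-isAbelianGroup
        ; *-cong     = ⊛-cong
        ; *-assoc    = ⊛-assoc
        ; *-identity = ⊛-identityˡ , λ f n → trans (⊛-comm f (const 1#) n) (⊛-identityˡ f n)
        ; distrib    = (λ h f g n → trans (⊛-comm h (f ⊕ g) n)
                                   (trans (⊛-distribʳ h f g n)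
                                          (+-cong (⊛-comm f h n) (⊛-comm g h n))))
                     , ⊛-distribʳ
        }
      ; *-comm = ⊛-comm
      }
    }

  divide-correct : ∀ {u} f g → g 0 * u ≈ 1# → divide u f g ⊛ g ≋ f
  divide-correct {u} f g gu≈1 zero = begin
    (u * f 0) * g 0 + 0# ≈⟨ +-identityʳ _ ⟩
    (u * f 0) * g 0      ≈⟨ *-comm _ _ ⟩
    g 0 * (u * f 0)      ≈⟨ *-assoc _ _ _ ⟨
    (g 0 * u) * f 0      ≈⟨ *-congʳ gu≈1 ⟩
    1# * f 0             ≈⟨ *-identityˡ _ ⟩
    f 0                  ∎
  divide-correct {u} f g gu≈1 (suc n) = begin
    q * g (suc n) + (divide u f′ g ⊛ g) n         ≈⟨ +-congˡ (divide-correct f′ g gu≈1 n) ⟩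
    q * g (suc n) + (f (suc n) - q * g (suc n))   ≈⟨ +-comm _ _ ⟩
    (f (suc n) - q * g (suc n)) + q * g (suc n)   ≈⟨ +-assoc _ _ _ ⟩
    f (suc n) + (- (q * g (suc n)) + q * g (suc n)) ≈⟨ +-congˡ (-‿inverseˡ _) ⟩
    f (suc n) + 0#                                ≈⟨ +-identityʳ _ ⟩
    f (suc n)                                     ∎
    where
    q = u * f 0
    f′ : Series
    f′ m = f (suc m) - q * g (suc m)

-- The ring R[[z]]; n · f is the n-fold sum of f.
module Univariate {c ℓ} (R : CommutativeRing c ℓ) where

  private
    module R where
      open CommutativeRing R public
      open Algebra.Properties.Semiring.Mult semiring public using (_×_)

  open FormalPowerSeries R public using (Series; powerSeries; divide; divide-correct)
  open CommutativeRing powerSeries public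
    using (_≈_; _+_; _*_; _-_; -_; 0#; 1#; semiring)
  open Algebra.Properties.Semiring.Exp semiring public using (_^_)
  open Algebra.Properties.Semiring.Mult semiring public using () renaming (_×_ to _·_)
  open Algebra.Properties.Semiring.Sum semiring public using (sum⁺-syntax)

  infixl 7 _/_

  z : Series
  z = FormalPowerSeries.var R

  -- The expansion of f / g at the origin, for g with constant term 1.
  _/_ : Series → Series → Series
  _/_ = divide R.1#

  /-correct : ∀ f g → g 0 R.≈ R.1# → (f / g) * g ≈ f
  /-correct f g g₀≈1 = divide-correct f g (R.trans (R.*-identityʳ (g 0)) g₀≈1)

  A : ℕ → Series
  A k n = binomiacci k n R.× R.1#

-- The ring R[[z]][[w]]: the coefficient of zⁿwᵏ in f is f k n.
module Bivariate {c ℓ} (R : CommutativeRing c ℓ) where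

  private
    module R where
      open CommutativeRing R public
      open Algebra.Properties.Semiring.Mult semiring public using (_×_)
    module R[[z]] where
      open Univariate R public
      open CommutativeRing powerSeries public using (trans; *-comm)
    module R[[z]][[w]] = FormalPowerSeries R[[z]].powerSeries

  open R[[z]][[w]] public using (Series; powerSeries)
  open CommutativeRing powerSeries public
    using (_≈_; _+_; _*_; _-_; -_; 0#; 1#; semiring)
  open Algebra.Properties.Semiring.Exp semiring public using (_^_)

  infixl 7 _/_

  z w : Series
  z = R[[z]][[w]].const R[[z]].z
  w = R[[z]][[w]].var

  -- The expansion of f / g at the origin, for g with constant term 1. As a
  -- series in w, g has constant term g 0, whose inverse is 1 / g 0 in R[[z]].
  _/_ : Series → Series → Series
  f / g = R[[z]][[w]].divide (R[[z]].1# R[[z]]./ g 0) f g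

  /-correct : ∀ f g → g 0 0 R.≈ R.1# → (f / g) * g ≈ f
  /-correct f g g₀₀≈1 = R[[z]][[w]].divide-correct f g
    (R[[z]].trans (R[[z]].*-comm (g 0) (R[[z]].1# R[[z]]./ g 0))
                  (R[[z]]./-correct R[[z]].1# (g 0) g₀₀≈1))

  G : Series
  G k n = binomiacci k n R.× R.1#

{-# OPTIONS --safe #-}
module Submission where

-- Comparing coefficients gives (1 - z) A (k+1) = A k + F (k+1) - F k, the last
-- difference being 0 for k = 0 and F (k-1) otherwise; the rows follow by
-- induction, since dividing by 1 - z is injective. Weighting the same recurrence
-- by powers of w, with P = 1 / (1 - z - z²) and Q = 1 / (1 - w - w²), gives
-- (1 - z - w) G = (1 - z) P + (1 - w) Q - 1.

open import Defs
open import Algebra.Bundles using (CommutativeRing)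
import Algebra.Properties.AbelianGroup
import Algebra.Properties.Semiring.Exp
import Algebra.Properties.Semiring.Mult
import Algebra.Properties.Semiring.Sum
import Algebra.Solver.Ring.NaturalCoefficients.Default
open import Data.Fin.Base using (toℕ; fromℕ; inject₁)
open import Data.Fin.Properties using (toℕ-fromℕ; toℕ-inject₁; toℕ≤pred[n])
open import Data.Nat.Base as ℕ using (ℕ; zero; suc; _≤_; _∸_; s≤s; z≤n)
open import Data.Nat.Properties using (+-∸-assoc; n∸n≡0)
open import Data.Product.Base using (_×_; _,_)
open import Relation.Binary.PropositionalEquality.Core as ≡ using (_≡_)
import Relation.Binary.Reasoning.Setoid

-- The column `n = 0` is covered by two defining clauses, so it reduces only after a split on `k`.
binomiacci-zeroʳ : ∀ k → binomiacci k 0 ≡ fib k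
binomiacci-zeroʳ zero    = ≡.refl
binomiacci-zeroʳ (suc k) = ≡.refl

-- Identities in a commutative ring

module RingIdentities {c ℓ} (S : CommutativeRing c ℓ) where

  open CommutativeRing S
  open Algebra.Properties.AbelianGroup +-abelianGroup using (ε⁻¹≈ε)
    renaming (∙-cancelʳ to +-cancelʳ; //-rightDividesˡ to x-y+y≈x)
  open Algebra.Properties.Semiring.Exp semiring using (_^_)
  open Algebra.Solver.Ring.NaturalCoefficients.Default commutativeSemiring
  open Relation.Binary.Reasoning.Setoid setoid

  x-0≈x : ∀ {x y} → y ≈ 0# → x - y ≈ x
  x-0≈x {x} {y} y≈0 = begin
    x - y  ≈⟨ +-congˡ (-‿cong y≈0) ⟩
    x - 0# ≈⟨ +-congˡ ε⁻¹≈ε ⟩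
    x + 0# ≈⟨ +-identityʳ x ⟩
    x      ∎

  -- `R` may have zero divisors, so cancellation rests on an explicit inverse `u` of `g`.
  *-cancelʳ-invertible : ∀ {u g f f′} → u * g ≈ 1# → f * g ≈ f′ * g → f ≈ f′
  *-cancelʳ-invertible {u} {g} {f} {f′} ug≈1 fg≈f′g = begin
    f            ≈⟨ expand f ⟩
    u * (f * g)  ≈⟨ *-congˡ fg≈f′g ⟩
    u * (f′ * g) ≈⟨ expand f′ ⟨
    f′           ∎
    where
    expand : ∀ x → x ≈ u * (x * g)
    expand x = begin
      x           ≈⟨ *-identityˡ x ⟨
      1# * x      ≈⟨ *-congʳ ug≈1 ⟨
      u * g * x   ≈⟨ solve 3 (λ u g x → u :* g :* x := u :* (x :* g)) refl u g x ⟩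
      u * (x * g) ∎

  -- Subtracted terms are kept on the other side of an identity: what remains is
  -- then a semiring identity, which the solver decides without a test for zero.
  *-minus : ∀ a c x → a * (c - x) + x * a ≈ a * c
  *-minus a c x = begin
    a * (c - x) + x * a ≈⟨ solve 3 (λ a d x → a :* d :+ x :* a := a :* (d :+ x)) refl a (c - x) x ⟩
    a * (c - x + x)     ≈⟨ *-congˡ (x-y+y≈x x c) ⟩
    a * c               ∎

  *-1-minus : ∀ a x → a * (1# - x) + x * a ≈ a
  *-1-minus a x = trans (*-minus a 1# x) (*-identityʳ a)

  *-1-minus-minus : ∀ a x y → a * (1# - x - y) + y * a + x * a ≈ a
  *-1-minus-minus a x y = trans (+-congʳ (*-minus a (1# - x) y)) (*-1-minus a x)

  -- Adding `x * a` to either side gives `a`, by `*-1-minus` and by the hypothesis. This turns a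
  -- recurrence on coefficients, with `x` as shift, into a product with the denominator.
  recurrence₁ : ∀ {a b x} → a ≈ b + x * a → a * (1# - x) ≈ b
  recurrence₁ {a} {b} {x} a≈ =
    +-cancelʳ (x * a) _ _ (trans (*-1-minus a x) a≈)

  recurrence₂ : ∀ {a b x} → a ≈ b + x * a + x * (x * a) → a * (1# - x - x ^ 2) ≈ b
  recurrence₂ {a} {b} {x} a≈ =
    +-cancelʳ (x ^ 2 * a) _ _ (+-cancelʳ (x * a) _ _ (begin
      a * (1# - x - x ^ 2) + x ^ 2 * a + x * a ≈⟨ *-1-minus-minus a x (x ^ 2) ⟩
      a                                        ≈⟨ a≈ ⟩
      b + x * a + x * (x * a)
        ≈⟨ solve 3 (λ a b x → b :+ x :* a :+ x :* (x :* a) := b :+ x :^ 2 :* a :+ x :* a) refl a b x ⟩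
      b + x ^ 2 * a + x * a                    ∎))

  -- With `s = z ^ 2` and `t = w ^ 2`, `a = p + s` and `b = q + t`. Expanding `(p + s) * (q + t)`
  -- shows that `a * q + b * p + s * t` equals `a * b + p * q`, and `a * b` is `1 - z - w + zw`.
  bivariate-numerator : ∀ z w →
    let a = 1# - z; b = 1# - w
        p = 1# - z - z ^ 2; q = 1# - w - w ^ 2
    in a * q + b * p ≈ (1# - z - w + z * w - z ^ 2 * w ^ 2) + p * q
  bivariate-numerator z w = +-cancelʳ (s * t) _ _ (begin
    a * q + b * p + s * t
      ≈⟨ +-congʳ (+-cong (*-congʳ (x-y+y≈x s a)) (*-congʳ (x-y+y≈x t b))) ⟨
    (p + s) * q + (q + t) * p + s * t
      ≈⟨ solve 4 (λ p q s t → (p :+ s) :* q :+ (q :+ t) :* p :+ s :* t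
                            := (p :+ s) :* (q :+ t) :+ p :* q) refl p q s t ⟩
    (p + s) * (q + t) + p * q
      ≈⟨ +-congʳ (*-cong (x-y+y≈x s a) (x-y+y≈x t b)) ⟩
    a * b + p * q           ≈⟨ +-congʳ ab≈m ⟩
    m + p * q               ≈⟨ +-congʳ (x-y+y≈x (s * t) m) ⟨
    (m - s * t) + s * t + p * q
      ≈⟨ solve 3 (λ n x y → n :+ x :+ y := n :+ y :+ x) refl (m - s * t) (s * t) (p * q) ⟩
    (m - s * t) + p * q + s * t ∎)
    where
    a b s t p q m : Carrier
    a = 1# - z
    b = 1# - w
    s = z ^ 2
    t = w ^ 2
    p = a - s
    q = b - t
    m = a - w + z * w

    ab≈m : a * b ≈ m
    ab≈m = +-cancelʳ (w * a) _ _ (begin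
      a * b + w * a           ≈⟨ *-1-minus a w ⟩
      a                       ≈⟨ x-y+y≈x w a ⟨
      a - w + w               ≈⟨ +-congˡ (*-identityʳ w) ⟨
      a - w + w * 1#          ≈⟨ +-congˡ (*-congˡ (x-y+y≈x z 1#)) ⟨
      a - w + w * (a + z)
        ≈⟨ solve 4 (λ d w a z → d :+ w :* (a :+ z) := d :+ z :* w :+ w :* a) refl (a - w) w a z ⟩
      m + w * a               ∎)

  -- The recurrence amounts to `G * r + 1# ≈ P * a + Q * b`. Multiplying by `p * q` replaces `P * p`
  -- and `Q * q` by 1 and leaves `a * q + b * p`, while the summand `1#` becomes the `p * q` that is
  -- cancelled at the end.
  bivariate-quotient : ∀ {z w P Q G} →
    P * (1# - z - z ^ 2) ≈ 1# → Q * (1# - w - w ^ 2) ≈ 1# →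
    G + w * Q + (1# + z * P) ≈ z * G + w * G + (P + Q) →
    G * ((1# - z - z ^ 2) * (1# - w - w ^ 2) * (1# - z - w))
      ≈ 1# - z - w + z * w - z ^ 2 * w ^ 2
  bivariate-quotient {z} {w} {P} {Q} {G} Pp≈1 Qq≈1 rec =
    +-cancelʳ (p * q) _ _ (begin
      G * (p * q * r) + p * q
        ≈⟨ solve 4 (λ G p q r → G :* (p :* q :* r) :+ p :* q
                              := (G :* r :+ con 1) :* (p :* q)) refl G p q r ⟩
      (G * r + 1#) * (p * q)        ≈⟨ *-congʳ Gr+1≈ ⟩
      (P * a + Q * b) * (p * q)
        ≈⟨ solve 6 (λ P Q a b p q → (P :* a :+ Q :* b) :* (p :* q)
                                  := a :* q :* (P :* p) :+ b :* p :* (Q :* q))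
                   refl P Q a b p q ⟩
      a * q * (P * p) + b * p * (Q * q)
        ≈⟨ +-cong (trans (*-congˡ Pp≈1) (*-identityʳ _)) (trans (*-congˡ Qq≈1) (*-identityʳ _)) ⟩
      a * q + b * p                 ≈⟨ bivariate-numerator z w ⟩
      (1# - z - w + z * w - z ^ 2 * w ^ 2) + p * q ∎)
    where
    a b p q r : Carrier
    a = 1# - z
    b = 1# - w
    p = 1# - z - z ^ 2
    q = 1# - w - w ^ 2
    r = 1# - z - w

    Gr+1≈ : G * r + 1# ≈ P * a + Q * b
    -- The four added terms are exactly those subtracted in expanding `G * r`, `Q * b` and `P * a`.
    Gr+1≈ = +-cancelʳ (w * G + z * G + w * Q + z * P) _ _ (begin
      G * r + 1# + (w * G + z * G + w * Q + z * P)
        ≈⟨ solve 5 (λ u x y v t → u :+ con 1 :+ (x :+ y :+ v :+ t)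
                                := u :+ x :+ y :+ v :+ (con 1 :+ t))
                   refl (G * r) (w * G) (z * G) (w * Q) (z * P) ⟩
      G * r + w * G + z * G + w * Q + (1# + z * P)
        ≈⟨ +-congʳ (+-congʳ (*-1-minus-minus G z w)) ⟩
      G + w * Q + (1# + z * P)             ≈⟨ rec ⟩
      z * G + w * G + (P + Q)
        ≈⟨ +-congˡ (+-cong (*-1-minus P z) (*-1-minus Q w)) ⟨
      z * G + w * G + ((P * a + z * P) + (Q * b + w * Q))
        ≈⟨ solve 6 (λ x y u v s t → x :+ y :+ ((u :+ s) :+ (v :+ t))
                                  := u :+ v :+ (y :+ x :+ t :+ s))
                   refl (z * G) (w * G) (P * a) (Q * b) (z * P) (w * Q) ⟩
      P * a + Q * b + (w * G + z * G + w * Q + z * P) ∎)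

-- Multiplication by the variable or a constant, and the Fibonacci series

module SeriesProperties {c ℓ} (R : CommutativeRing c ℓ) where

  open CommutativeRing R
  open FormalPowerSeries R
  open Algebra.Properties.Semiring.Mult semiring using () renaming (_×_ to _·_; ×-homo-+ to ·-homo-+)
  open Relation.Binary.Reasoning.Setoid setoid

  ⊛-headˡ-0 : ∀ {f} g → f 0 ≈ 0# → (f ⊛ g) 0 ≈ 0#
  ⊛-headˡ-0 g f₀≈0 = trans (+-identityʳ _) (trans (*-congʳ f₀≈0) (zeroˡ (g 0)))

  var-⊛-zero : ∀ f → (var ⊛ f) 0 ≈ 0#
  var-⊛-zero f = ⊛-headˡ-0 {var} f refl

  -- The tail of `var` is the unit series, so multiplying by `var` is a shift by one.
  var-⊛-suc : ∀ f n → (var ⊛ f) (suc n) ≈ f n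
  var-⊛-suc f n = begin
    0# * f (suc n) + (tail var ⊛ f) n
      ≈⟨ +-cong (zeroˡ _) (⊛-cong {f = tail var} {g = f} tail-var (λ _ → refl) n) ⟩
    0# + (const 1# ⊛ f) n ≈⟨ +-identityˡ _ ⟩
    (const 1# ⊛ f) n      ≈⟨ ⊛-identityˡ f n ⟩
    f n                   ∎
    where
    tail-var : tail var ≋ const 1#
    tail-var zero    = refl
    tail-var (suc _) = refl

  const-⊛ : ∀ a f n → (const a ⊛ f) n ≈ a * f n
  const-⊛ a f zero    = +-identityʳ _
  const-⊛ a f (suc n) = trans (+-congˡ (⊛-zeroˡ f n)) (+-identityʳ _)

  -- Over `R` this is the row `A 0`; over `R[[z]]` it is the series `Q` in w. One recurrence serves
  -- both.
  fibonacci : Series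
  fibonacci n = fib n · 1#

  -- The single constant 1 yields both initial values: directly in degree 0, and through one shift
  -- in degree 1, where the double shift still vanishes.
  fibonacci-recurrence :
    fibonacci ≋ const 1# ⊕ var ⊛ fibonacci ⊕ var ⊛ (var ⊛ fibonacci)
  fibonacci-recurrence zero = sym (begin
    1# + (var ⊛ fibonacci) 0 + (var ⊛ (var ⊛ fibonacci)) 0
      ≈⟨ +-cong (+-congˡ (var-⊛-zero fibonacci)) (var-⊛-zero (var ⊛ fibonacci)) ⟩
    1# + 0# + 0# ≈⟨ +-identityʳ _ ⟩
    1# + 0#      ∎)
  fibonacci-recurrence (suc zero) = sym (begin
    0# + (var ⊛ fibonacci) 1 + (var ⊛ (var ⊛ fibonacci)) 1
      ≈⟨ +-cong (trans (+-identityˡ _) (var-⊛-suc fibonacci 0))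
                (trans (var-⊛-suc (var ⊛ fibonacci) 0) (var-⊛-zero fibonacci)) ⟩
    fibonacci 0 + 0# ≈⟨ +-identityʳ _ ⟩
    fibonacci 0      ∎)
  fibonacci-recurrence (suc (suc n)) = sym (begin
    0# + (var ⊛ fibonacci) (2 ℕ.+ n) + (var ⊛ (var ⊛ fibonacci)) (2 ℕ.+ n)
      ≈⟨ +-cong (trans (+-identityˡ _) (var-⊛-suc fibonacci (suc n)))
                (trans (var-⊛-suc (var ⊛ fibonacci) (suc n)) (var-⊛-suc fibonacci n)) ⟩
    fibonacci (suc n) + fibonacci n ≈⟨ ·-homo-+ 1# (fib (suc n)) (fib n) ⟨
    fibonacci (2 ℕ.+ n)             ∎)

-- Quotients and rows in R[[z]]

module UnivariateProperties {c ℓ} (R : CommutativeRing c ℓ) where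

  private
    module R where
      open CommutativeRing R public
      open Algebra.Properties.Semiring.Mult semiring public
      open RingIdentities R public
      open SeriesProperties R public
      open Relation.Binary.Reasoning.Setoid setoid public

  open Univariate R
  open CommutativeRing powerSeries
    using (refl; sym; trans; setoid; +-cong; +-congˡ; +-congʳ; +-assoc; +-comm; +-identityʳ;
           *-congˡ; *-congʳ; *-assoc; *-identityʳ; distribʳ; reflexive; +-abelianGroup)
  open Algebra.Properties.AbelianGroup +-abelianGroup using ()
    renaming (∙-cancelʳ to +-cancelʳ)
  open Algebra.Properties.Semiring.Mult semiring using () renaming (×-homo-+ to ·-homo-+)
  open Algebra.Properties.Semiring.Sum semiring
    using (sum-syntax; *-distribʳ-sum; sum-cong-≋; sum-init-last)
  open RingIdentities powerSeries using (*-cancelʳ-invertible; recurrence₁; recurrence₂)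
  open Relation.Binary.Reasoning.Setoid setoid

  -- The condition under which `_/_` is a true quotient.
  HasUnitHead : Series → Set ℓ
  HasUnitHead g = g 0 R.≈ R.1#

  *-unitHead : ∀ {f g} → HasUnitHead f → HasUnitHead g → HasUnitHead (f * g)
  *-unitHead f₀≈1 g₀≈1 =
    R.trans (R.+-identityʳ _) (R.trans (R.*-cong f₀≈1 g₀≈1) (R.*-identityʳ _))

  ^-unitHead : ∀ {f} → HasUnitHead f → ∀ n → HasUnitHead (f ^ n)
  ^-unitHead f₀≈1 zero    = R.refl
  ^-unitHead {f} f₀≈1 (suc n) = *-unitHead {f} {f ^ n} f₀≈1 (^-unitHead {f} f₀≈1 n)

  *-cancelʳ-unitHead : ∀ {g f f′} → HasUnitHead g → f * g ≈ f′ * g → f ≈ f′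
  *-cancelʳ-unitHead {g} g₀≈1 = *-cancelʳ-invertible {1# / g} (/-correct 1# g g₀≈1)

  /-unique : ∀ {f g h} → HasUnitHead g → f * g ≈ h → f ≈ h / g
  /-unique {f} {g} {h} g₀≈1 fg≈h =
    *-cancelʳ-unitHead g₀≈1 (trans fg≈h (sym (/-correct h g g₀≈1)))

  -- Both sides give `f` when multiplied by `e`. In the induction on rows this lowers the power of
  -- `1 - z` in a denominator by one.
  /-cancel : ∀ {d e g} f → HasUnitHead d → HasUnitHead e → g ≈ d * e → f / g * d ≈ f / e
  /-cancel {d} {e} {g} f d₀≈1 e₀≈1 g≈de = /-unique e₀≈1 (begin
    f / g * d * e   ≈⟨ *-assoc (f / g) d e ⟩
    f / g * (d * e) ≈⟨ *-congˡ {f / g} g≈de ⟨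
    f / g * g       ≈⟨ /-correct f g (R.trans (g≈de 0) (*-unitHead {d} {e} d₀≈1 e₀≈1)) ⟩
    f               ∎)

  ·1-zero : ∀ n → (n · 1#) 0 R.≈ n R.× R.1#
  ·1-zero zero    = R.refl
  ·1-zero (suc n) = R.+-congˡ (·1-zero n)

  ·1-suc : ∀ n m → (n · 1#) (suc m) R.≈ R.0#
  ·1-suc zero    m = R.refl
  ·1-suc (suc n) m = R.trans (R.+-identityˡ _) (·1-suc n m)

  -- Recurrences between consecutive rows

  A₀-recurrence : A 0 ≈ 1# + z * A 0 + z * (z * A 0)
  A₀-recurrence = R.fibonacci-recurrence

  -- In positive degree the constants vanish and the defining recurrence of the array remains. In
  -- degree 0 the shifted row vanishes, and the constants compensate for the rows starting with
  -- `fib k` and `fib (suc k)`.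
  A-recurrence : ∀ k → A (suc k) + fib k · 1# ≈ z * A (suc k) + A k + fib (suc k) · 1#
  A-recurrence k zero = R.begin
    F′ R.+ (fib k · 1#) 0
      R.≈⟨ R.+-comm _ _ ⟩
    (fib k · 1#) 0 R.+ F′
      R.≈⟨ R.+-cong (R.trans (·1-zero (fib k)) (R.×-congˡ (≡.sym (binomiacci-zeroʳ k))))
                    (R.sym (·1-zero (fib (suc k)))) ⟩
    A k 0 R.+ (fib (suc k) · 1#) 0
      R.≈⟨ R.+-congʳ (R.trans (R.+-congʳ (R.var-⊛-zero (A (suc k)))) (R.+-identityˡ (A k 0))) ⟨
    (z * A (suc k)) 0 R.+ A k 0 R.+ (fib (suc k) · 1#) 0 R.∎
    where
    F′ = fib (suc k) R.× R.1#
  A-recurrence k (suc n) = R.begin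
    A (suc k) (suc n) R.+ (fib k · 1#) (suc n)
      R.≈⟨ R.+-cong (R.×-homo-+ R.1# (binomiacci (suc k) n) (binomiacci k (suc n)))
                    (R.trans (·1-suc (fib k) n) (R.sym (·1-suc (fib (suc k)) n))) ⟩
    A (suc k) n R.+ A k (suc n) R.+ (fib (suc k) · 1#) (suc n)
      R.≈⟨ R.+-congʳ (R.+-congʳ (R.var-⊛-suc (A (suc k)) n)) ⟨
    (z * A (suc k)) (suc n) R.+ A k (suc n) R.+ (fib (suc k) · 1#) (suc n) R.∎

  d D : Series
  d = 1# - z
  D = 1# - z - z ^ 2

  d-unitHead : HasUnitHead d
  d-unitHead = R.x-0≈x R.refl

  D-unitHead : HasUnitHead D
  D-unitHead = R.trans (R.x-0≈x (R.⊛-headˡ-0 {z} (z ^ 1) R.refl)) d-unitHead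

  A₀*D : A 0 * D ≈ 1#
  A₀*D = recurrence₂ A₀-recurrence

  -- The constants `fib 0` and `fib 1` are equal and cancel, so row 1 gets no extra summand.
  A₁*d : A 1 * d ≈ A 0
  A₁*d = recurrence₁ (+-cancelʳ (1 · 1#) _ _
    (trans (A-recurrence 0) (+-congʳ {1 · 1#} (+-comm (z * A 1) (A 0)))))

  -- The boundary constants differ by `fib (2 + k) - fib (1 + k)`, which is `fib k`.
  A*d : ∀ k → A (2 ℕ.+ k) * d ≈ A (1 ℕ.+ k) + fib k · 1#
  A*d k = recurrence₁ (+-cancelʳ f₁ _ _ (begin
    a₂ + f₁               ≈⟨ A-recurrence (suc k) ⟩
    z * a₂ + a₁ + fib (2 ℕ.+ k) · 1#
      ≈⟨ +-cong (+-comm (z * a₂) a₁)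
                (trans (·-homo-+ 1# (fib (suc k)) (fib k)) (+-comm f₁ f₀)) ⟩
    a₁ + z * a₂ + (f₀ + f₁) ≈⟨ +-assoc (a₁ + z * a₂) f₀ f₁ ⟨
    a₁ + z * a₂ + f₀ + f₁
      ≈⟨ +-congʳ {f₁} (trans (+-assoc a₁ (z * a₂) f₀)
           (trans (+-congˡ {a₁} (+-comm (z * a₂) f₀)) (sym (+-assoc a₁ f₀ (z * a₂))))) ⟩
    a₁ + f₀ + z * a₂ + f₁ ∎))
    where
    a₁ a₂ f₀ f₁ : Series
    a₁ = A (1 ℕ.+ k)
    a₂ = A (2 ℕ.+ k)
    f₀ = fib k · 1#
    f₁ = fib (suc k) · 1#

  A₁*dD : A 1 * (d * D) ≈ 1#
  A₁*dD = begin
    A 1 * (d * D) ≈⟨ *-assoc (A 1) d D ⟨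
    A 1 * d * D   ≈⟨ *-congʳ {D} A₁*d ⟩
    A 0 * D       ≈⟨ A₀*D ⟩
    1#            ∎

  -- Closed form of the rows

  leading : ℕ → Series
  leading k = 1# / (d ^ k * D)

  -- `leading` is indexed by the row, `term` by the row minus one: in row `k + 1` the exponent is
  -- `k - i`.
  term : ℕ → ℕ → Series
  term k i = fib i · 1# / d ^ (k ∸ i)

  d^n*D-unitHead : ∀ n → HasUnitHead (d ^ n * D)
  d^n*D-unitHead n = *-unitHead {d ^ n} {D} (^-unitHead {d} d-unitHead n) D-unitHead

  leading*d : ∀ k → leading (suc k) * d ≈ leading k
  leading*d k = /-cancel 1# d-unitHead (d^n*D-unitHead k) (*-assoc d (d ^ k) D)

  term*d : ∀ {k i} → i ≤ k → term (suc k) i * d ≈ term k i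
  -- The bound `i ≤ k` makes `suc k ∸ i` equal to `suc (k ∸ i)`, so the power unfolds with a factor
  -- `d` in front.
  term*d {k} {i} i≤k rewrite +-∸-assoc 1 i≤k =
    /-cancel (fib i · 1#) d-unitHead (^-unitHead {d} d-unitHead (k ∸ i)) refl

  term-diagonal : ∀ k → term k k ≈ fib k · 1#
  term-diagonal k rewrite n∸n≡0 k =
    sym (/-unique R.refl (*-identityʳ (fib k · 1#)))

  -- Every summand loses one factor of its denominator. The last one has exponent 1 and becomes the
  -- constant `fib k`, which is the correction in `A*d`.
  sum*d : ∀ k → (∑[ i ≤ k ] term (suc k) (toℕ i)) * d
              ≈ ∑[ i < k ] term k (toℕ i) + fib k · 1#
  sum*d k = begin
    (∑[ i ≤ k ] term (suc k) (toℕ i)) * d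
      ≈⟨ *-distribʳ-sum {suc k} d (λ i → term (suc k) (toℕ i)) ⟩
    ∑[ i ≤ k ] (term (suc k) (toℕ i) * d)
      ≈⟨ sum-cong-≋ {suc k} (λ i → term*d (toℕ≤pred[n] i)) ⟩
    ∑[ i ≤ k ] term k (toℕ i)
      ≈⟨ sum-init-last {k} (λ i → term k (toℕ i)) ⟩
    ∑[ i < k ] term k (toℕ (inject₁ i)) + term k (toℕ (fromℕ k))
      ≈⟨ +-cong (sum-cong-≋ {k} (λ i → reflexive (≡.cong (term k) (toℕ-inject₁ i))))
                (trans (reflexive (≡.cong (term k) (toℕ-fromℕ k))) (term-diagonal k)) ⟩
    ∑[ i < k ] term k (toℕ i) + fib k · 1# ∎

  -- The base is row 1, where the sum is empty. In the step, both sides times `d` reduce to the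
  -- formula for the previous row plus `fib k`.
  A-quotient : ∀ k → A (suc k) ≈ leading (suc k) + ∑[ i < k ] term k (toℕ i)
  A-quotient zero = begin
    A 1            ≈⟨ /-unique (d^n*D-unitHead 1)
                        (trans (*-congˡ {A 1} (*-congʳ {D} (*-identityʳ d))) A₁*dD) ⟩
    leading 1      ≈⟨ +-identityʳ (leading 1) ⟨
    leading 1 + 0# ∎
  A-quotient (suc k) = *-cancelʳ-unitHead d-unitHead (begin
    A (2 ℕ.+ k) * d                                 ≈⟨ A*d k ⟩
    A (1 ℕ.+ k) + F                                 ≈⟨ +-congʳ {F} (A-quotient k) ⟩
    leading (1 ℕ.+ k) + Σ₀ + F                      ≈⟨ +-assoc (leading (1 ℕ.+ k)) Σ₀ F ⟩
    leading (1 ℕ.+ k) + (Σ₀ + F)                    ≈⟨ +-cong (leading*d (1 ℕ.+ k)) (sum*d k) ⟨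
    leading (2 ℕ.+ k) * d + Σ₁ * d                  ≈⟨ distribʳ d (leading (2 ℕ.+ k)) Σ₁ ⟨
    (leading (2 ℕ.+ k) + Σ₁) * d                    ∎)
    where
    F Σ₀ Σ₁ : Series
    F  = fib k · 1#
    Σ₀ = ∑[ i < k ] term k (toℕ i)
    Σ₁ = ∑[ i ≤ k ] term (suc k) (toℕ i)

-- The bivariate generating function in R[[z]][[w]]

module BivariateProperties {c ℓ} (R : CommutativeRing c ℓ) where

  private
    module R where
      open CommutativeRing R public
      open RingIdentities R public
      open SeriesProperties R public
    module R[[z]] where
      open Univariate R public
      open CommutativeRing powerSeries public
        using (refl; sym; trans; setoid; +-cong; +-congˡ; +-congʳ; +-assoc; +-comm;
               +-identityˡ; +-identityʳ; *-congˡ; zeroʳ)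
      open UnivariateProperties R public
      open SeriesProperties powerSeries public
      open Relation.Binary.Reasoning.Setoid setoid public
    module R[[z]][[w]] = FormalPowerSeries R[[z]].powerSeries

  open Bivariate R
  open CommutativeRing powerSeries using (sym; trans)
  open RingIdentities powerSeries using (*-cancelʳ-invertible; recurrence₂; bivariate-quotient)

  HasUnitHead : Series → Set ℓ
  HasUnitHead g = R[[z]].HasUnitHead (g 0)

  *-unitHead : ∀ {f g} → HasUnitHead f → HasUnitHead g → HasUnitHead (f * g)
  *-unitHead {f} {g} f₀≈1 g₀≈1 =
    R.trans (R.+-identityʳ _) (R[[z]].*-unitHead {f 0} {g 0} f₀≈1 g₀≈1)

  *-headˡ-0 : ∀ {f} g → f 0 0 R.≈ R.0# → (f * g) 0 0 R.≈ R.0#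
  *-headˡ-0 {f} g f₀≈0 = R.trans (R.+-identityʳ _) (R.⊛-headˡ-0 {f 0} (g 0) f₀≈0)

  /-unique : ∀ {f g h} → HasUnitHead g → f * g ≈ h → f ≈ h / g
  /-unique {f} {g} {h} g₀≈1 fg≈h =
    *-cancelʳ-invertible {1# / g} (/-correct 1# g g₀≈1) (trans fg≈h (sym (/-correct h g g₀≈1)))

  -- The generating functions of the two borders of the array: `P` is constant in w, and the
  -- coefficients of `Q` are constant in z.
  P Q : Series
  P = R[[z]][[w]].const (R[[z]].A 0)
  Q = R[[z]].fibonacci

  -- As a series in w, the variable `z` is constant, so it acts on each row separately.
  z*-coefficient : ∀ f k → (z * f) k R[[z]].≈ R[[z]].z R[[z]].* f k
  z*-coefficient = R[[z]].const-⊛ R[[z]].z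

  -- The coefficient of w^0 is the univariate recurrence; in higher degree in w all terms vanish.
  P-recurrence : P ≈ 1# + z * P + z * (z * P)
  P-recurrence k = R[[z]].trans (coefficient k) (R[[z]].sym
    (R[[z]].+-cong (R[[z]].+-congˡ {1# k} (z*-coefficient P k))
                   (R[[z]].trans (z*-coefficient (z * P) k)
                                 (R[[z]].*-congˡ {R[[z]].z} (z*-coefficient P k)))))
    where
    open R[[z]] using () renaming (z to ζ; _*_ to _⋆_; _+_ to _⊹_; 0# to 𝟘; _≈_ to _≋_)
    coefficient : ∀ k → P k ≋ 1# k ⊹ ζ ⋆ P k ⊹ ζ ⋆ (ζ ⋆ P k)
    coefficient zero    = R[[z]].A₀-recurrence
    coefficient (suc k) = R[[z]].sym (R[[z]].begin
      𝟘 ⊹ ζ ⋆ 𝟘 ⊹ ζ ⋆ (ζ ⋆ 𝟘)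
        R[[z]].≈⟨ R[[z]].+-cong (R[[z]].+-congˡ {𝟘} (R[[z]].zeroʳ ζ))
                                (R[[z]].trans (R[[z]].*-congˡ {ζ} (R[[z]].zeroʳ ζ)) (R[[z]].zeroʳ ζ)) ⟩
      𝟘 ⊹ 𝟘 ⊹ 𝟘 R[[z]].≈⟨ R[[z]].+-identityʳ (𝟘 ⊹ 𝟘) ⟩
      𝟘 ⊹ 𝟘     R[[z]].≈⟨ R[[z]].+-identityʳ 𝟘 ⟩
      𝟘         R[[z]].∎)

  -- In degree 0 in w, `G` and `P` both have the row `A 0`, and `Q` contributes 1. In degree `k + 1`
  -- the terms with `P` vanish and `A-recurrence k` remains: `w * Q` supplies `fib k` and `Q`
  -- supplies `fib (suc k)`.
  G-recurrence : G + w * Q + (1# + z * P) ≈ z * G + w * G + (P + Q)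
  G-recurrence zero = R[[z]].begin
    A₀ ⊹ (w * Q) 0 ⊹ (𝟙 ⊹ (z * P) 0)
      R[[z]].≈⟨ R[[z]].+-cong (R[[z]].trans (R[[z]].+-congˡ {A₀} (R[[z]].var-⊛-zero Q)) (R[[z]].+-identityʳ A₀))
                              (R[[z]].+-comm 𝟙 ((z * P) 0)) ⟩
    A₀ ⊹ (zP₀ ⊹ 𝟙)   R[[z]].≈⟨ R[[z]].+-assoc A₀ zP₀ 𝟙 ⟨
    A₀ ⊹ zP₀ ⊹ 𝟙     R[[z]].≈⟨ R[[z]].+-congʳ {𝟙} (R[[z]].+-comm A₀ zP₀) ⟩
    zP₀ ⊹ A₀ ⊹ 𝟙     R[[z]].≈⟨ R[[z]].+-assoc zP₀ A₀ 𝟙 ⟩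
    zP₀ ⊹ (A₀ ⊹ 𝟙)
      R[[z]].≈⟨ R[[z]].+-cong
                  (R[[z]].trans (R[[z]].+-congˡ {(z * G) 0} (R[[z]].var-⊛-zero G))
                    (R[[z]].trans (R[[z]].+-identityʳ ((z * G) 0))
                      (R[[z]].trans (z*-coefficient G 0) (R[[z]].sym (z*-coefficient P 0)))))
                  (R[[z]].+-congˡ {A₀} (R[[z]].+-identityʳ 𝟙)) ⟨
    (z * G) 0 ⊹ (w * G) 0 ⊹ (P 0 ⊹ Q 0) R[[z]].∎
    where
    open R[[z]] using () renaming (_+_ to _⊹_; 1# to 𝟙)
    A₀ zP₀ : R[[z]].Series
    A₀  = R[[z]].A 0
    zP₀ = (z * P) 0
  G-recurrence (suc k) = R[[z]].begin
    A₁ ⊹ (w * Q) (suc k) ⊹ (𝟘 ⊹ (z * P) (suc k))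
      R[[z]].≈⟨ R[[z]].+-cong
                  (R[[z]].+-congˡ {A₁} (R[[z]].var-⊛-suc Q k))
                  (R[[z]].trans (R[[z]].+-identityˡ ((z * P) (suc k)))
                    (R[[z]].trans (z*-coefficient P (suc k)) (R[[z]].zeroʳ R[[z]].z))) ⟩
    A₁ ⊹ Q k ⊹ 𝟘   R[[z]].≈⟨ R[[z]].+-identityʳ (A₁ ⊹ Q k) ⟩
    A₁ ⊹ Q k       R[[z]].≈⟨ R[[z]].A-recurrence k ⟩
    R[[z]].z R[[z]].* A₁ ⊹ G k ⊹ Q (suc k)
      R[[z]].≈⟨ R[[z]].+-cong
                  (R[[z]].+-cong (z*-coefficient G (suc k)) (R[[z]].var-⊛-suc G k))
                  (R[[z]].+-identityˡ (Q (suc k))) ⟨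
    (z * G) (suc k) ⊹ (w * G) (suc k) ⊹ (𝟘 ⊹ Q (suc k)) R[[z]].∎
    where
    open R[[z]] using () renaming (_+_ to _⊹_; 0# to 𝟘)
    A₁ : R[[z]].Series
    A₁ = R[[z]].A (suc k)

  denominator : Series
  denominator = (1# - z - z ^ 2) * (1# - w - w ^ 2) * (1# - z - w)

  denominator-unitHead : HasUnitHead denominator
  denominator-unitHead =
    *-unitHead {(1# - z - z ^ 2) * (1# - w - w ^ 2)} {1# - z - w}
      (*-unitHead {1# - z - z ^ 2} {1# - w - w ^ 2}
        (minus {z} {z ^ 2} R.refl (*-headˡ-0 {z} (z ^ 1) R.refl))
        (minus {w} {w ^ 2} R.refl (*-headˡ-0 {w} (w ^ 1) R.refl)))
      (minus {z} {w} R.refl R.refl)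
    where
    minus : ∀ {f g} → f 0 0 R.≈ R.0# → g 0 0 R.≈ R.0# → HasUnitHead (1# - f - g)
    minus f₀≈0 g₀≈0 = R.trans (R.x-0≈x g₀≈0) (R.x-0≈x f₀≈0)

  G-quotient : G ≈ (1# - z - w + z * w - z ^ 2 * w ^ 2) / denominator
  G-quotient = /-unique {g = denominator} denominator-unitHead
    (bivariate-quotient {z} {w} {P} {Q} {G}
      (recurrence₂ P-recurrence) (recurrence₂ R[[z]].fibonacci-recurrence) G-recurrence)

lemma2p1 : ∀ {c ℓ} (R : CommutativeRing c ℓ) →
    (let open Univariate R in
        (A 0 ≈ 1# / (1# - z - z ^ 2))
      × (A 1 ≈ 1# / ((1# - z) * (1# - z - z ^ 2)))
      × (∀ k → 2 ≤ k →
          A k ≈ 1# / ((1# - z) ^ k * (1# - z - z ^ 2))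
                + ∑[ i ≤ k ∸ 2 ] (fib (toℕ i) · 1# / (1# - z) ^ (k ∸ 1 ∸ toℕ i))))
    ×
    (let open Bivariate R in
      G ≈ (1# - z - w + z * w - z ^ 2 * w ^ 2)
          / ((1# - z - z ^ 2) * (1# - w - w ^ 2) * (1# - z - w)))
lemma2p1 R =
  ( /-unique D-unitHead A₀*D
  , /-unique (*-unitHead {d} {D} d-unitHead D-unitHead) A₁*dD
  -- For row `2 + k` the sum over `i ≤ k` is by definition the one over `i < suc k`, and the
  -- exponent `k ∸ 1 ∸ toℕ i` of the statement becomes `suc k ∸ toℕ i`.
  , λ { (suc (suc k)) (s≤s (s≤s z≤n)) → A-quotient (suc k) }
  ) , BivariateProperties.G-quotient R
  where open UnivariateProperties R
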